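{- Let $\Sigma$ be a finite alphabet, let $u, v \in \Sigma^\star$ and $n \in \mathbb N$. If $u \equiv^2_{|\Sigma|+1,n} v$, then $u \equiv^2_n v$.
   Context: A word $w=w_1\cdots w_{|w|}\in\Sigma^\star$ is identified with the structure with universe $\{1,\dots,|w|\}$, linear order $<$, and unary relations $Q_{\mathtt a}=\{i:w_i=\mathtt a\}$, $\mathtt a\in\Sigma$. $\mathrm{FO}^2_n[<]$ is the set of first-order formulas over this vocabulary using only variables $x,y$ (which may be requantified) with quantifier depth at most $n$; $\mathrm{FO}^2_{m,n}[<]$ consists of those formulas of $\mathrm{FO}^2_n[<]$ such that any path in their parse tree has at most $m$ blocks of alternating quantifiers. $u\equiv^2_n v$ (resp. $u\equiv^2_{m,n}v$) means $u$ and $v$ satisfy the same sentences of $\mathrm{FO}^2_n[<]$ (resp. $\mathrm{FO}^2_{m,n}[<]$). -}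

module Defs where

open import Data.Nat using (ℕ; zero; suc; _⊔_; _≤_; _<ᵇ_)
open import Data.Fin using (Fin; toℕ)
open import Data.Fin.Properties using () renaming (_≟_ to _≟ᶠ_)
open import Data.Bool using (Bool; true; false; _∧_; _∨_; not)
open import Data.List using (List; length; lookup; allFin)
open import Data.Bool.ListAction using (any; all)
open import Data.Maybe using (Maybe; just; nothing)
open import Data.Product using (_×_)
open import Relation.Nullary using (¬_)
open import Relation.Nullary.Decidable using (⌊_⌋)
open import Relation.Binary.PropositionalEquality using (_≡_)

-- Alphabet Σ is represented as Fin k, so |Σ| = k.
-- The two variables x and y.
data Var : Set where
  x y : Var

data Quant : Set where
  ∃q ∀q : Quant

-- FO²[<] formulas over alphabet Fin k, in negation normal form
-- (negation only in front of atomic formulas).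
data Formula (k : ℕ) : Set where
  ⊤f ⊥f  : Formula k
  letter : Fin k → Var → Formula k
  nletter : Fin k → Var → Formula k
  less   : Var → Var → Formula k
  nless  : Var → Var → Formula k
  eq     : Var → Var → Formula k
  neq    : Var → Var → Formula k
  _∧f_ _∨f_ : Formula k → Formula k → Formula k
  quant  : Quant → Var → Formula k → Formula k

qd : ∀ {k} → Formula k → ℕ
qd (φ ∧f ψ) = qd φ ⊔ qd ψ
qd (φ ∨f ψ) = qd φ ⊔ qd ψ
qd (quant _ _ φ) = suc (qd φ)
qd _ = 0

sameQ : Quant → Quant → Bool
sameQ ∃q ∃q = true
sameQ ∀q ∀q = true
sameQ _ _ = false

-- maximal number of blocks of alternating quantifiers along a path of the
-- parse tree, given the type of the nearest enclosing quantifier (if any)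
blocksFrom : ∀ {k} → Maybe Quant → Formula k → ℕ
blocksFrom c (φ ∧f ψ) = blocksFrom c φ ⊔ blocksFrom c ψ
blocksFrom c (φ ∨f ψ) = blocksFrom c φ ⊔ blocksFrom c ψ
blocksFrom nothing (quant q _ φ) = suc (blocksFrom (just q) φ)
blocksFrom (just q') (quant q _ φ) with sameQ q' q
... | true  = blocksFrom (just q) φ
... | false = suc (blocksFrom (just q) φ)
blocksFrom _ _ = 0

blocks : ∀ {k} → Formula k → ℕ
blocks = blocksFrom nothing

data FreeIn {k : ℕ} (v : Var) : Formula k → Set where
  letter  : ∀ {a} → FreeIn v (letter a v)
  nletter : ∀ {a} → FreeIn v (nletter a v)
  lessˡ : ∀ {w} → FreeIn v (less v w)
  lessʳ : ∀ {w} → FreeIn v (less w v)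
  nlessˡ : ∀ {w} → FreeIn v (nless v w)
  nlessʳ : ∀ {w} → FreeIn v (nless w v)
  eqˡ : ∀ {w} → FreeIn v (eq v w)
  eqʳ : ∀ {w} → FreeIn v (eq w v)
  neqˡ : ∀ {w} → FreeIn v (neq v w)
  neqʳ : ∀ {w} → FreeIn v (neq w v)
  ∧ˡ : ∀ {φ ψ} → FreeIn v φ → FreeIn v (φ ∧f ψ)
  ∧ʳ : ∀ {φ ψ} → FreeIn v ψ → FreeIn v (φ ∧f ψ)
  ∨ˡ : ∀ {φ ψ} → FreeIn v φ → FreeIn v (φ ∨f ψ)
  ∨ʳ : ∀ {φ ψ} → FreeIn v ψ → FreeIn v (φ ∨f ψ)
  under : ∀ {q w φ} → ¬ (v ≡ w) → FreeIn v φ → FreeIn v (quant q w φ)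

Sentence : ∀ {k} → Formula k → Set
Sentence φ = ∀ v → ¬ FreeIn v φ

Word : ℕ → Set
Word k = List (Fin k)

-- positions of w are Fin (length w) (0-based; order-isomorphic to {1..|w|})
Assign : ∀ {k} → Word k → Set
Assign w = Var → Maybe (Fin (length w))

update : ∀ {k} {w : Word k} → Assign w → Var → Fin (length w) → Assign w
update σ x i x = just i
update σ y i y = just i
update σ x i y = σ y
update σ y i x = σ x

-- partial assignment; atoms mentioning an unassigned variable are false
-- (irrelevant for sentences)
eval : ∀ {k} (w : Word k) → Assign w → Formula k → Bool
eval w σ ⊤f = true
eval w σ ⊥f = false
eval w σ (letter a v) with σ v
... | just i = ⌊ lookup w i ≟ᶠ a ⌋
... | nothing = false
eval w σ (nletter a v) with σ v
... | just i = not ⌊ lookup w i ≟ᶠ a ⌋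
... | nothing = false
eval w σ (less v v') with σ v | σ v'
... | just i | just j = toℕ i <ᵇ toℕ j
... | _ | _ = false
eval w σ (nless v v') with σ v | σ v'
... | just i | just j = not (toℕ i <ᵇ toℕ j)
... | _ | _ = false
eval w σ (eq v v') with σ v | σ v'
... | just i | just j = ⌊ i ≟ᶠ j ⌋
... | _ | _ = false
eval w σ (neq v v') with σ v | σ v'
... | just i | just j = not ⌊ i ≟ᶠ j ⌋
... | _ | _ = false
eval w σ (φ ∧f ψ) = eval w σ φ ∧ eval w σ ψ
eval w σ (φ ∨f ψ) = eval w σ φ ∨ eval w σ ψ
eval w σ (quant ∃q v φ) = any (λ i → eval w (update {w = w} σ v i) φ) (allFin (length w))
eval w σ (quant ∀q v φ) = all (λ i → eval w (update {w = w} σ v i) φ) (allFin (length w))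

_⊨_ : ∀ {k} → Word k → Formula k → Bool
w ⊨ φ = eval w (λ _ → nothing) φ

Equiv2 : ∀ {k} → ℕ → Word k → Word k → Set
Equiv2 n u v = ∀ φ → Sentence φ → qd φ ≤ n → u ⊨ φ ≡ v ⊨ φ

Equiv2Alt : ∀ {k} → ℕ → ℕ → Word k → Word k → Set
Equiv2Alt m n u v = ∀ φ → Sentence φ → qd φ ≤ n → blocks φ ≤ m → u ⊨ φ ≡ v ⊨ φ

{-# OPTIONS --safe #-}

-- A ranker is a sequence of instructions "go to the next/previous a", started at one end of the
-- word. If two words agree on the order of their rankers of depth < n, and on which letters occur
-- between two of them, then Duplicator wins the n-round two-pebble game: she answers within the
-- gap between rankers that Spoiler's pebble lies in.
--
-- The comparisons needed are expressible with k + 1 quantifier blocks because rankers may be taken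
-- to zoom in: after a step from q to p, a step back either stays strictly between q and p, or ends
-- at q, or equals the same step made from q, which is a shorter ranker; likewise for a step that
-- overshoots the enclosing interval. Each change of direction thus restricts the ranker to an
-- interval missing one more letter, so a zooming ranker has at most k blocks of directions.

module Submission where

open import Defs
open import Data.Bool using (Bool; true; false; T; not)
open import Data.Bool.Properties using (T-∧; T-∨)
open import Data.Empty using (⊥; ⊥-elim)
open import Data.Fin using (Fin; toℕ)
open import Data.Fin.Properties using (toℕ-injective; toℕ<n; any?; injective⇒≤) renaming (_≟_ to _≟ᶠ_)
open import Data.List using (List; []; _∷_; _++_; length; lookup; allFin; cartesianProduct; cartesianProductWith)
open import Data.List.Membership.Propositional using (_∈_; lose; find)
open import Data.List.Membership.Propositional.Properties using (∈-allFin; ∈-lookup; ∈-++⁺ˡ; ∈-++⁺ʳ; ∈-++⁻; ∈-cartesianProduct⁺; ∈-cartesianProductWith⁺; ∈-cartesianProductWith⁻)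
open import Data.List.Relation.Unary.All using (All; []; _∷_; all?; tabulate) renaming (lookup to lookupAll)
open import Data.List.Relation.Unary.All.Properties using (all⁺; all⁻; ¬Any⇒All¬)
open import Data.List.Relation.Unary.AllPairs using ([]; _∷_)
open import Data.List.Relation.Unary.Any using (here; there)
open import Data.List.Relation.Unary.Any.Properties using (any⁺; any⁻)
open import Data.List.Relation.Unary.Unique.Propositional using (Unique)
open import Data.Maybe using (Maybe; just; nothing)
open import Data.Nat using (ℕ; zero; suc; _≤_; _<_; z≤n; s≤s; s≤s⁻¹)
open import Data.Nat.Properties
open import Data.Product using (∃; _×_; _,_; proj₁; proj₂)
open import Data.Sum using (_⊎_; inj₁; inj₂; [_,_])
open import Data.Unit using (tt)
open import Function using (_∘_; id)
open import Function.Bundles using (_⇔_; mk⇔; Equivalence)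
open import Relation.Binary.Definitions using (tri<; tri≈; tri>)
open import Relation.Nullary using (¬_; Dec; yes; no)
open import Relation.Nullary.Decidable using (toWitness; fromWitness; toWitnessFalse; fromWitnessFalse; _×-dec_)
open import Relation.Binary.PropositionalEquality using (_≡_; refl; sym; trans; cong; subst)

open Equivalence using (to; from)

-- Order relations on positions, up to reflection.

data Direction : Set where
  right left : Direction

flip : Direction → Direction
flip right = left
flip left  = right

data Strictness : Set where
  strict weak : Strictness

-- Chosen so that the negation of `Rel d c p q` is `Rel (flip d) (dual c) p q`, with the points in
-- the same order.
dual : Strictness → Strictness
dual strict = weak
dual weak   = strict

Below : Strictness → ℕ → ℕ → Set
Below strict = _<_
Below weak   = _≤_

-- Read as: `q` lies ahead of `p` when facing in direction `d`. Left-right symmetric arguments are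
-- thereby given only once.
Rel : Direction → Strictness → ℕ → ℕ → Set
Rel right c p q = Below c p q
Rel left  c p q = Below c q p

Rel-swap : ∀ d {c p q} → Rel d c p q → Rel (flip d) c q p
Rel-swap right r = r
Rel-swap left  r = r

Rel-unswap : ∀ d {c p q} → Rel (flip d) c q p → Rel d c p q
Rel-unswap right r = r
Rel-unswap left  r = r

Rel? : ∀ d c p q → Dec (Rel d c p q)
Rel? right strict p q = p <? q
Rel? right weak   p q = p ≤? q
Rel? left  strict p q = q <? p
Rel? left  weak   p q = q ≤? p

Rel-refl : ∀ d {p} → Rel d weak p p
Rel-refl right = ≤-refl
Rel-refl left  = ≤-refl

Rel-weaken : ∀ d c {p q} → Rel d strict p q → Rel d c p q
Rel-weaken right strict r = r
Rel-weaken right weak   r = <⇒≤ r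
Rel-weaken left  strict r = r
Rel-weaken left  weak   r = <⇒≤ r

Rel-transˡ : ∀ d c {p q r} → Rel d weak p q → Rel d c q r → Rel d c p r
Rel-transˡ right strict s t = ≤-<-trans s t
Rel-transˡ right weak   s t = ≤-trans s t
Rel-transˡ left  strict s t = <-≤-trans t s
Rel-transˡ left  weak   s t = ≤-trans t s

Rel-trans : ∀ d {p q r} → Rel d strict p q → Rel d strict q r → Rel d strict p r
Rel-trans d s t = Rel-transˡ d strict (Rel-weaken d weak s) t

Rel-absurd : ∀ d c {p q} → Rel d c p q → Rel (flip d) (dual c) p q → ⊥
Rel-absurd right strict = <⇒≱
Rel-absurd right weak   = ≤⇒≯
Rel-absurd left  strict = <⇒≱
Rel-absurd left  weak   = ≤⇒≯

Rel-dichotomy : ∀ d c p q → Rel d c p q ⊎ Rel (flip d) (dual c) p q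
Rel-dichotomy d c p q with Rel? d c p q
... | yes r = inj₁ r
Rel-dichotomy right strict p q | no r = inj₂ (≮⇒≥ r)
Rel-dichotomy right weak   p q | no r = inj₂ (≰⇒> r)
Rel-dichotomy left  strict p q | no r = inj₂ (≮⇒≥ r)
Rel-dichotomy left  weak   p q | no r = inj₂ (≰⇒> r)

Rel-antisym : ∀ d {p q} → Rel d weak p q → Rel (flip d) weak p q → p ≡ q
Rel-antisym right = ≤-antisym
Rel-antisym left  s t = ≤-antisym t s

Rel-irrefl : ∀ d {p} → Rel d strict p p → ⊥
Rel-irrefl d r = Rel-absurd d strict r (Rel-refl (flip d))

Rel-trichotomy : ∀ d p q → Rel d strict p q ⊎ p ≡ q ⊎ Rel (flip d) strict p q
Rel-trichotomy right p q with <-cmp p q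
... | tri< p<q _ _ = inj₁ p<q
... | tri≈ _ p≡q _ = inj₂ (inj₁ p≡q)
... | tri> _ _ p>q = inj₂ (inj₂ p>q)
Rel-trichotomy left p q with <-cmp p q
... | tri< p<q _ _ = inj₂ (inj₂ p<q)
... | tri≈ _ p≡q _ = inj₂ (inj₁ p≡q)
... | tri> _ _ p>q = inj₁ p>q

data SameOrFlip (d : Direction) : Direction → Set where
  same    : SameOrFlip d d
  flipped : SameOrFlip d (flip d)

compare-dir : ∀ d e → SameOrFlip d e
compare-dir right right = same
compare-dir right left  = flipped
compare-dir left  right = flipped
compare-dir left  left  = same

flip-flip : ∀ d → flip (flip d) ≡ d
flip-flip right = refl
flip-flip left  = refl

Rel-diagonal : ∀ d c {p q} → Rel d c p p → Rel d c q q
Rel-diagonal d strict r = ⊥-elim (Rel-irrefl d r)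
Rel-diagonal d weak   _ = Rel-refl d

-- The complement of each of these relations is another one of them, so preserving all of them
-- amounts to reflecting all of them.
Rel-reflect : ∀ {p q p′ q′} → (∀ d c → Rel d c p q → Rel d c p′ q′) → ∀ d c → Rel d c p′ q′ → Rel d c p q
Rel-reflect {p} {q} f d c r with Rel-dichotomy d c p q
... | inj₁ s = s
... | inj₂ s = ⊥-elim (Rel-absurd d c r (f (flip d) (dual c) s))

-- A strict relation settles all the others: those in direction `d` hold and those in direction
-- `flip d` fail, for both pairs.
Rel-transport : ∀ d {p q p′ q′} → Rel d strict p q → Rel d strict p′ q′ →
                ∀ e c → Rel e c p q → Rel e c p′ q′
Rel-transport d r r′ e c s with compare-dir d e
... | same = Rel-weaken d c r′
Rel-transport d r r′ e strict s | flipped =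
  ⊥-elim (Rel-absurd d weak (Rel-weaken d weak r) s)
Rel-transport d r r′ e weak   s | flipped = ⊥-elim (Rel-absurd d strict r s)

-- Nearest elements of a list, and lengths of duplicate-free lists.

nearest : ∀ {A : Set} (d : Direction) (f : A → ℕ) {P : A → Set} → (∀ m → Dec (P m)) →
  (ms : List A) →
  (∀ {m} → m ∈ ms → ¬ P m) ⊎
  ∃ λ m → m ∈ ms × P m × (∀ {l} → l ∈ ms → P l → Rel d weak (f m) (f l))
nearest d f P? [] = inj₁ λ ()
nearest d f P? (m ∷ ms) with P? m | nearest d f P? ms
... | no ¬Pm | inj₁ none = inj₁ λ { (here refl) → ¬Pm ; (there l∈) → none l∈ }
... | no ¬Pm | inj₂ (l , l∈ , Pl , min) =
  inj₂ (l , there l∈ , Pl , λ { (here refl) Pm → ⊥-elim (¬Pm Pm) ; (there o∈) → min o∈ })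
... | yes Pm | inj₁ none =
  inj₂ (m , here refl , Pm , λ { (here refl) _ → Rel-refl d ; (there o∈) Po → ⊥-elim (none o∈ Po) })
... | yes Pm | inj₂ (l , l∈ , Pl , min) with Rel-dichotomy d weak (f m) (f l)
... | inj₁ m≼l = inj₂ (m , here refl , Pm ,
  λ { (here refl) _ → Rel-refl d ; (there o∈) Po → Rel-transˡ d weak m≼l (min o∈ Po) })
... | inj₂ l≺m = inj₂ (l , there l∈ , Pl ,
  λ { (here refl) _ → Rel-weaken d weak (Rel-unswap d l≺m) ; (there o∈) Po → min o∈ Po })

unique⇒lookup-injective : ∀ {A : Set} {ms : List A} → Unique ms →
  ∀ i j → lookup ms i ≡ lookup ms j → i ≡ j
unique⇒lookup-injective {ms = _ ∷ _} _ Fin.zero Fin.zero _ = refl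
unique⇒lookup-injective {ms = _ ∷ ms} (m∉ ∷ _) Fin.zero (Fin.suc j) e =
  ⊥-elim (lookupAll m∉ (∈-lookup j) e)
unique⇒lookup-injective {ms = _ ∷ ms} (m∉ ∷ _) (Fin.suc i) Fin.zero e =
  ⊥-elim (lookupAll m∉ (∈-lookup i) (sym e))
unique⇒lookup-injective {ms = _ ∷ _} (_ ∷ u) (Fin.suc i) (Fin.suc j) e =
  cong Fin.suc (unique⇒lookup-injective u i j e)

unique⇒length≤ : ∀ {k} {S : List (Fin k)} → Unique S → length S ≤ k
unique⇒length≤ u = injective⇒≤ (unique⇒lookup-injective u _ _)

-- Satisfaction

Sat : ∀ {k} (w : Word k) → Assign w → Formula k → Set
Sat w σ φ = T (eval w σ φ)

module _ {k : ℕ} (w : Word k) (σ : Assign w) where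

  sat-∃ : ∀ z (φ : Formula k) →
    Sat w σ (quant ∃q z φ) ⇔ ∃ λ i → Sat w (update {w = w} σ z i) φ
  sat-∃ z φ = mk⇔
    (λ s → let i , _ , t = find (any⁻ holds (allFin _) s) in i , t)
    (λ (i , t) → any⁺ holds (lose (∈-allFin i) t))
    where holds = λ i → eval w (update {w = w} σ z i) φ

  sat-∀ : ∀ z (φ : Formula k) →
    Sat w σ (quant ∀q z φ) ⇔ (∀ i → Sat w (update {w = w} σ z i) φ)
  sat-∀ z φ = mk⇔
    (λ s i → lookupAll (all⁺ holds (allFin _) s) (∈-allFin i))
    (λ t → all⁻ holds {allFin _} (tabulate λ {i} _ → t i))
    where holds = λ i → eval w (update {w = w} σ z i) φ

  sat-letter : ∀ {a z i} → σ z ≡ just i → Sat w σ (letter a z) ⇔ lookup w i ≡ a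
  sat-letter e rewrite e = mk⇔ toWitness fromWitness

  sat-nletter : ∀ {a z i} → σ z ≡ just i → Sat w σ (nletter a z) ⇔ (¬ lookup w i ≡ a)
  sat-nletter e rewrite e = mk⇔ toWitnessFalse fromWitnessFalse

belowF : ∀ {k} → Strictness → Var → Var → Formula k
belowF strict z z′ = less z z′
belowF weak   z z′ = nless z′ z

relF : ∀ {k} → Direction → Strictness → Var → Var → Formula k
relF right c z z′ = belowF c z z′
relF left  c z z′ = belowF c z′ z

-- Shifted by one, so that `0` is free for the sentinel on the left.
pos : ∀ {n} → Fin n → ℕ
pos i = suc (toℕ i)

pos-injective : ∀ {n} {i j : Fin n} → pos i ≡ pos j → i ≡ j
pos-injective = toℕ-injective ∘ suc-injective

T⇔⇒≡ : ∀ {b b′} → (T b → T b′) → (T b′ → T b) → b ≡ b′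
T⇔⇒≡ {false} {false} f g = refl
T⇔⇒≡ {false} {true}  f g = ⊥-elim (g tt)
T⇔⇒≡ {true}  {false} f g = ⊥-elim (f tt)
T⇔⇒≡ {true}  {true}  f g = refl

T-not : ∀ {b} → T (not b) ⇔ (¬ T b)
T-not {false} = mk⇔ (λ _ ()) (λ _ → tt)
T-not {true}  = mk⇔ (λ ()) (λ f → f tt)

module _ {k : ℕ} (w : Word k) (σ : Assign w) where

  sat-belowF : ∀ c {z z′ i i′} → σ z ≡ just i → σ z′ ≡ just i′ →
    Sat w σ (belowF c z z′) ⇔ Below c (pos i) (pos i′)
  sat-belowF strict e e′ rewrite e | e′ = mk⇔ (s≤s ∘ <ᵇ⇒< _ _) λ { (s≤s r) → <⇒<ᵇ r }
  sat-belowF weak   e e′ rewrite e′ | e = mk⇔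
    (λ t → s≤s (≮⇒≥ λ r → to T-not t (<⇒<ᵇ r)))
    λ { (s≤s r) → from T-not λ t → ≤⇒≯ r (<ᵇ⇒< _ _ t) }

  sat-relF : ∀ d c {z z′ i i′} → σ z ≡ just i → σ z′ ≡ just i′ →
    Sat w σ (relF d c z z′) ⇔ Rel d c (pos i) (pos i′)
  sat-relF right c e e′ = sat-belowF c e e′
  sat-relF left  c e e′ = sat-belowF c e′ e

other : Var → Var
other x = y
other y = x

data SameOrOther (z : Var) : Var → Set where
  same    : SameOrOther z z
  swapped : SameOrOther z (other z)

compare-var : ∀ z z′ → SameOrOther z z′
compare-var x x = same
compare-var x y = swapped
compare-var y x = swapped
compare-var y y = same

update-same : ∀ {k} (w : Word k) (σ : Assign w) z i → update {w = w} σ z i z ≡ just i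
update-same w σ x i = refl
update-same w σ y i = refl

update-other : ∀ {k} (w : Word k) (σ : Assign w) z i → update {w = w} σ (other z) i z ≡ σ z
update-other w σ x i = refl
update-other w σ y i = refl

-- Rankers

data Ranker (k : ℕ) : Set where
  origin : Direction → Ranker k
  step   : Direction → Fin k → Ranker k → Ranker k

depth : ∀ {k} → Ranker k → ℕ
depth (origin _)   = 0
depth (step _ _ r) = suc (depth r)

-- Changes of direction in r followed by a move in direction d.
alternations : ∀ {k} → Ranker k → Direction → ℕ
alternations (origin _)   d = 0
alternations (step e _ r) d with compare-dir e d
... | same    = alternations r e
... | flipped = suc (alternations r e)

alternations-same : ∀ {k} d a (r : Ranker k) → alternations (step d a r) d ≡ alternations r d
alternations-same right a r = refl
alternations-same left  a r = refl

alternations-flip : ∀ {k} d a (r : Ranker k) →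
  alternations (step d a r) (flip d) ≡ suc (alternations r d)
alternations-flip right a r = refl
alternations-flip left  a r = refl

-- Holds at the positions beyond r in direction d: Σ-shaped when d is the direction of the last
-- step of r, Π-shaped otherwise, so that only changes of direction cost an alternation.
beyond : ∀ {k} → Ranker k → Direction → Strictness → Var → Formula k
beyond (origin e) d c z with compare-dir e d
... | same    = ⊤f
... | flipped = ⊥f
beyond (step e a r) d c z with compare-dir e d
... | same    = quant ∃q (other z)
  ((relF d c (other z) z ∧f letter a (other z)) ∧f beyond r d strict (other z))
... | flipped = quant ∀q (other z)
  ((relF d c (other z) z ∨f nletter a (other z)) ∨f beyond r d weak (other z))

qd-relF : ∀ {k} d c {z z′} → qd (relF {k} d c z z′) ≡ 0
qd-relF right strict = refl
qd-relF right weak   = refl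
qd-relF left  strict = refl
qd-relF left  weak   = refl

qd-beyond : ∀ {k} (r : Ranker k) d c z → qd (beyond r d c z) ≤ depth r
qd-beyond (origin e) d c z with compare-dir e d
... | same    = z≤n
... | flipped = z≤n
qd-beyond {k} (step e a r) d c z with compare-dir e d
... | same    rewrite qd-relF {k} d c {other z} {z} = s≤s (qd-beyond r d strict (other z))
... | flipped rewrite qd-relF {k} d c {other z} {z} = s≤s (qd-beyond r d weak (other z))

blocks-relF : ∀ {k} q d c {z z′} → blocksFrom (just q) (relF {k} d c z z′) ≡ 0
blocks-relF q right strict = refl
blocks-relF q right weak   = refl
blocks-relF q left  strict = refl
blocks-relF q left  weak   = refl

-- The two bounds are dual, since `beyond r (flip d) (dual c)` is `beyond r d c` with quantifiers
-- and connectives exchanged and atoms negated. A last step in direction `d` yields the enclosing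
-- quantifier and costs nothing; a step the other way opens a block, just where `alternations`
-- counts one.
blocks-beyond-∃ : ∀ {k} (r : Ranker k) d c z →
  blocksFrom (just ∃q) (beyond r d c z) ≤ alternations r d
blocks-beyond-∀ : ∀ {k} (r : Ranker k) d c z →
  blocksFrom (just ∀q) (beyond r (flip d) c z) ≤ alternations r d
blocks-beyond-∃ (origin right) right c z = z≤n
blocks-beyond-∃ (origin right) left  c z = z≤n
blocks-beyond-∃ (origin left)  right c z = z≤n
blocks-beyond-∃ (origin left)  left  c z = z≤n
blocks-beyond-∃ {k} (step right a r) right c z rewrite blocks-relF {k} ∃q right c {other z} {z} =
  blocks-beyond-∃ r right strict (other z)
blocks-beyond-∃ {k} (step right a r) left c z rewrite blocks-relF {k} ∀q left c {other z} {z} =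
  s≤s (blocks-beyond-∀ r right weak (other z))
blocks-beyond-∃ {k} (step left a r) right c z rewrite blocks-relF {k} ∀q right c {other z} {z} =
  s≤s (blocks-beyond-∀ r left weak (other z))
blocks-beyond-∃ {k} (step left a r) left c z rewrite blocks-relF {k} ∃q left c {other z} {z} =
  blocks-beyond-∃ r left strict (other z)
blocks-beyond-∀ (origin right) right c z = z≤n
blocks-beyond-∀ (origin right) left  c z = z≤n
blocks-beyond-∀ (origin left)  right c z = z≤n
blocks-beyond-∀ (origin left)  left  c z = z≤n
blocks-beyond-∀ {k} (step right a r) right c z rewrite blocks-relF {k} ∀q left c {other z} {z} =
  blocks-beyond-∀ r right weak (other z)
blocks-beyond-∀ {k} (step right a r) left c z rewrite blocks-relF {k} ∃q right c {other z} {z} =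
  s≤s (blocks-beyond-∃ r right strict (other z))
blocks-beyond-∀ {k} (step left a r) right c z rewrite blocks-relF {k} ∃q left c {other z} {z} =
  s≤s (blocks-beyond-∃ r left strict (other z))
blocks-beyond-∀ {k} (step left a r) left c z rewrite blocks-relF {k} ∀q right c {other z} {z} =
  blocks-beyond-∀ r left weak (other z)

free-relF : ∀ {k z} d c {z₁ z₂} → FreeIn {k} z (relF d c z₁ z₂) → z ≡ z₁ ⊎ z ≡ z₂
free-relF right strict lessˡ  = inj₁ refl
free-relF right strict lessʳ  = inj₂ refl
free-relF right weak   nlessˡ = inj₂ refl
free-relF right weak   nlessʳ = inj₁ refl
free-relF left  strict lessˡ  = inj₂ refl
free-relF left  strict lessʳ  = inj₁ refl
free-relF left  weak   nlessˡ = inj₁ refl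
free-relF left  weak   nlessʳ = inj₂ refl

free-beyond : ∀ {k} (r : Ranker k) d c z {z′} → FreeIn z′ (beyond r d c z) → z′ ≡ z
free-beyond (origin e) d c z f with compare-dir e d
free-beyond (origin e) d c z () | same
free-beyond (origin e) d c z () | flipped
free-beyond (step e a r) d c z f with compare-dir e d
free-beyond (step e a r) d c z (under z′≢ (∧ˡ (∧ˡ f))) | same =
  [ (λ z′≡ → ⊥-elim (z′≢ z′≡)) , id ] (free-relF d c f)
free-beyond (step e a r) d c z (under z′≢ (∧ˡ (∧ʳ letter))) | same = ⊥-elim (z′≢ refl)
free-beyond (step e a r) d c z (under z′≢ (∧ʳ f)) | same =
  ⊥-elim (z′≢ (free-beyond r d strict (other z) f))
free-beyond (step e a r) d c z (under z′≢ (∨ˡ (∨ˡ f))) | flipped =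
  [ (λ z′≡ → ⊥-elim (z′≢ z′≡)) , id ] (free-relF d c f)
free-beyond (step e a r) d c z (under z′≢ (∨ˡ (∨ʳ nletter))) | flipped = ⊥-elim (z′≢ refl)
free-beyond (step e a r) d c z (under z′≢ (∨ʳ f)) | flipped =
  ⊥-elim (z′≢ (free-beyond r d weak (other z) f))

-- Positions of rankers and the truth of `beyond`.

-- Sentinels: the letters of w occupy the positions 1, …, length w.
start : ∀ {k} → Direction → Word k → ℕ
start right w = 0
start left  w = suc (length w)

start-before : ∀ {k} d (w : Word k) i → Rel d strict (start d w) (pos {length w} i)
start-before right w i = s≤s z≤n
start-before left  w i = s≤s (toℕ<n i)

HasLetter : ∀ {k} → Word k → Fin k → ℕ → Set
HasLetter w a p = ∃ λ i → lookup w i ≡ a × pos i ≡ p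

record First {k} (w : Word k) (d : Direction) (a : Fin k) (q p : ℕ) : Set where
  constructor mkFirst
  field
    at    : HasLetter w a p
    ahead : Rel d strict q p
    least : ∀ j → lookup w j ≡ a → Rel d strict q (pos j) → Rel d weak p (pos j)

data Reaches {k} (w : Word k) : Ranker k → ℕ → Set where
  origin : ∀ d → Reaches w (origin d) (start d w)
  step   : ∀ {r d a q p} → Reaches w r q → First w d a q p → Reaches w (step d a r) p

-- Let `q` be the point before the last step. Facing as that step did, a position is beyond `p` iff
-- it is beyond some `a` ahead of `q`, because `p` is the nearest of these. It lies on the other
-- side of `p` iff it lies on that side of every `a` ahead of `q`; there the quantifier is
-- instantiated at `p` to recover the relation.
sat-beyond : ∀ {k} (w : Word k) {r p} → Reaches w r p → (σ : Assign w) → ∀ d c {z i} →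
  σ z ≡ just i → Sat w σ (beyond r d c z) ⇔ Rel d c p (pos i)
sat-beyond w (origin e) σ d c {i = i} σz with compare-dir e d
... | same    = mk⇔ (λ _ → Rel-weaken e c (start-before e w i)) (λ _ → tt)
... | flipped = mk⇔ (λ ()) (absurd c)
  where
  absurd : ∀ c → Rel (flip e) c (start e w) (pos i) → ⊥
  absurd strict s = Rel-absurd e weak (Rel-weaken e weak (start-before e w i)) s
  absurd weak   s = Rel-absurd e strict (start-before e w i) s
sat-beyond w (step {r} {e} {a} {q} {p} ρ (mkFirst (j , wj , refl) ahead least)) σ d c {z} {i} σz
  with compare-dir e d
... | same = mk⇔ there′ back
  where
  body = (relF d c (other z) z ∧f letter a (other z)) ∧f beyond r d strict (other z)
  module _ (l : Fin (length w)) where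
    τ = update {w = w} σ (other z) l
    τz = trans (update-other w σ z l) σz
    τz′ = update-same w σ (other z) l
  there′ : Sat w σ (quant ∃q (other z) body) → Rel d c p (pos i)
  there′ s with to (sat-∃ w σ (other z) body) s
  ... | l , t with to T-∧ t
  ... | t₁₂ , t₃ with to T-∧ t₁₂
  ... | t₁ , t₂ = Rel-transˡ d c
    (least l (to (sat-letter w (τ l) (τz′ l)) t₂) (to (sat-beyond w ρ (τ l) d strict (τz′ l)) t₃))
    (to (sat-relF w (τ l) d c (τz′ l) (τz l)) t₁)
  back : Rel d c p (pos i) → Sat w σ (quant ∃q (other z) body)
  back s = from (sat-∃ w σ (other z) body) (j , from T-∧
    ( from T-∧ (from (sat-relF w (τ j) d c (τz′ j) (τz j)) s , from (sat-letter w (τ j) (τz′ j)) wj)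
    , from (sat-beyond w ρ (τ j) d strict (τz′ j)) ahead))
... | flipped = mk⇔ there′ back
  where
  body = (relF d c (other z) z ∨f nletter a (other z)) ∨f beyond r d weak (other z)
  module _ (l : Fin (length w)) where
    τ = update {w = w} σ (other z) l
    τz = trans (update-other w σ z l) σz
    τz′ = update-same w σ (other z) l
  there′ : Sat w σ (quant ∀q (other z) body) → Rel d c p (pos i)
  there′ s with to T-∨ (to (sat-∀ w σ (other z) body) s j)
  ... | inj₂ t₃ = ⊥-elim (Rel-absurd e strict ahead (to (sat-beyond w ρ (τ j) d weak (τz′ j)) t₃))
  ... | inj₁ t₁₂ with to T-∨ t₁₂
  ... | inj₁ t₁ = to (sat-relF w (τ j) d c (τz′ j) (τz j)) t₁
  ... | inj₂ t₂ = ⊥-elim (to (sat-nletter w (τ j) (τz′ j)) t₂ wj)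
  back : Rel d c p (pos i) → Sat w σ (quant ∀q (other z) body)
  back s = from (sat-∀ w σ (other z) body) λ l → from T-∨ (clause l)
    where
    clause : ∀ l → Sat w (τ l) (relF d c (other z) z ∨f nletter a (other z)) ⊎
                   Sat w (τ l) (beyond r d weak (other z))
    clause l with lookup w l ≟ᶠ a | Rel-dichotomy e strict q (pos l)
    ... | no wl≢ | _ = inj₁ (from T-∨ (inj₂ (from (sat-nletter w (τ l) (τz′ l)) wl≢)))
    ... | yes _ | inj₂ l≼q = inj₂ (from (sat-beyond w ρ (τ l) d weak (τz′ l)) l≼q)
    ... | yes wl | inj₁ q≺l = inj₁ (from T-∨ (inj₁ (from (sat-relF w (τ l) d c (τz′ l) (τz l))
      (Rel-transˡ d c (Rel-swap e (least l wl q≺l)) s))))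

-- The next occurrence of a letter.

module _ {k : ℕ} (w : Word k) (d : Direction) (a : Fin k) where

  -- Made total by a default: when no `a` is ahead, the search runs into the far sentinel. Thus
  -- `next` is defined everywhere, unlike `First`.
  firstAfter : ∀ q → ∃ λ p → First w d a q p ⊎
    ((∀ j → lookup w j ≡ a → ¬ Rel d strict q (pos j)) × p ≡ start (flip d) w)
  firstAfter q with nearest d pos (λ j → (lookup w j ≟ᶠ a) ×-dec Rel? d strict q (pos j)) (allFin _)
  ... | inj₁ none = _ , inj₂ ((λ j wj q≺j → none (∈-allFin j) (wj , q≺j)) , refl)
  ... | inj₂ (i , _ , (wi , q≺i) , min) =
    pos i , inj₁ (mkFirst (i , wi , refl) q≺i λ j wj q≺j → min (∈-allFin j) (wj , q≺j))

  next : ℕ → ℕ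
  next q = proj₁ (firstAfter q)

  next-first : ∀ {q p} → First w d a q p → next q ≡ p
  next-first {q} (mkFirst (i , wi , refl) q≺i least) with proj₂ (firstAfter q)
  ... | inj₂ (none , _) = ⊥-elim (none i wi q≺i)
  ... | inj₁ (mkFirst (j , wj , j≡) q≺n least′) = Rel-antisym d (least′ i wi q≺i)
    (Rel-swap d (subst (Rel d weak (pos i)) j≡ (least j wj (subst (Rel d strict q) (sym j≡) q≺n))))

  next-none : ∀ {q} → (∀ j → lookup w j ≡ a → ¬ Rel d strict q (pos j)) → next q ≡ start (flip d) w
  next-none {q} none with proj₂ (firstAfter q)
  ... | inj₂ (_ , n≡) = n≡
  ... | inj₁ (mkFirst (j , wj , j≡) q≺n _) = ⊥-elim (none j wj (subst (Rel d strict q) (sym j≡) q≺n))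

  module _ {q t} (q≺t : Rel d strict q t)
    (empty : ∀ j → lookup w j ≡ a → Rel d strict q (pos j) → ¬ Rel (flip d) strict t (pos j))
    (t≢a : ¬ HasLetter w a t) where

    passes : ∀ j → lookup w j ≡ a → Rel d strict q (pos j) → Rel d strict t (pos j)
    passes j wj q≺j with Rel-trichotomy d t (pos j)
    ... | inj₁ t≺j        = t≺j
    ... | inj₂ (inj₁ t≡j) = ⊥-elim (t≢a (j , wj , sym t≡j))
    ... | inj₂ (inj₂ j≺t) = ⊥-elim (empty j wj q≺j j≺t)

    -- Each `a` ahead of `q` is ahead of `t` as well, so both searches agree, also in the default
    -- case. Serves steps that overshoot the bound `t`.
    next-skip : next q ≡ next t
    next-skip with proj₂ (firstAfter t)
    ... | inj₁ (mkFirst at ahead least) =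
      next-first (mkFirst at (Rel-trans d q≺t ahead) λ j wj q≺j → least j wj (passes j wj q≺j))
    ... | inj₂ (none , n≡) = trans (next-none λ j wj q≺j → none j wj (passes j wj q≺j)) (sym n≡)

-- Zooming rankers in two words.

record Leg {k} (w : Word k) (d : Direction) (a : Fin k) (S : List (Fin k)) (q p t : ℕ) : Set where
  constructor mkLeg
  field
    first  : First w d a q p
    inside : Rel d strict p t
    avoids : ∀ i → lookup w i ∈ S → Rel d strict q (pos i) → ¬ Rel d strict (pos i) t

-- The two words form a family over `Bool`, so that each transfer result is proved once for both
-- directions. A `Point` is meant as the pair of positions of one ranker in the two words.
module Comparison {k N : ℕ} (W : Bool → Word k)
  (E : ∀ b b′ → Equiv2Alt (suc k) N (W b) (W b′)) where

  Point : Set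
  Point = Bool → ℕ

  -- S consists of letters missing between the previous position Q and the bound T; every change
  -- of direction adds the letter just found to S, so there are fewer than k changes.
  data Zoom : Ranker k → Point → Set where
    origin : ∀ {P} d → (∀ b → P b ≡ start d (W b)) → Zoom (origin d) P
    step   : ∀ {r s Q T P d a} S → Zoom r Q → Zoom s T → depth s ≤ suc (depth r) →
             Unique S → alternations r d ≤ length S →
             (∀ b → Leg (W b) d a S (Q b) (P b) (T b)) → Zoom (step d a r) P

  zoom-resp : ∀ {r P P′} → (∀ b → P b ≡ P′ b) → Zoom r P → Zoom r P′
  zoom-resp P≡ (origin d P≡s) = origin d λ b → trans (sym (P≡ b)) (P≡s b)
  zoom-resp P≡ (step S ζ ξ s≤r u alt leg) = step S ζ ξ s≤r u alt λ b →
    subst (λ p → Leg (W b) _ _ S _ p _) (P≡ b) (leg b)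

  reaches : ∀ {r P} → Zoom r P → ∀ b → Reaches (W b) r (P b)
  reaches (origin d P≡s) b rewrite P≡s b = origin d
  reaches (step _ ζ _ _ _ _ leg) b = step (reaches ζ b) (Leg.first (leg b))

  leg-fresh : ∀ {w : Word k} {d a S q p t} → Leg w d a S q p t → ¬ a ∈ S
  leg-fresh (mkLeg (mkFirst (i , refl , refl) ahead _) inside avoids) a∈S = avoids i a∈S ahead inside

  -- The last letter is not in `S`, so `a ∷ S` is duplicate-free and `suc (length S)` is at most
  -- `k`. The further move in direction `e` adds at most one change to those bounded by `length S`.
  alternations≤k : ∀ {r P} → Zoom r P → ∀ e → alternations r e ≤ k
  alternations≤k (origin _ _) e = z≤n
  alternations≤k (step {r} {d = d} {a} S _ _ _ u alt leg) e = ≤-trans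
    bound (unique⇒length≤ (¬Any⇒All¬ S (leg-fresh (leg true)) ∷ u))
    where
    bound : alternations (step d a r) e ≤ suc (length S)
    bound with compare-dir d e
    ... | same    = m≤n⇒m≤1+n alt
    ... | flipped = s≤s alt

  -- The depth is strictly below `N` because one quantifier is spent on the position being
  -- constrained.
  record Constraint : Set where
    constructor constraint
    field
      {ranker} : Ranker k
      {point}  : Point
      zoom     : Zoom ranker point
      shallow  : depth ranker < N
      dir      : Direction
      str      : Strictness

  open Constraint

  Meets : ∀ b → Fin (length (W b)) → Constraint → Set
  Meets b i κ = Rel (dir κ) (str κ) (point κ b) (pos i)

  Witness : Fin k → List Constraint → Bool → Set
  Witness a κs b = ∃ λ i → lookup (W b) i ≡ a × All (Meets b i) κs

  conjunction : List Constraint → Formula k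
  conjunction []       = ⊤f
  conjunction (κ ∷ κs) = beyond (ranker κ) (dir κ) (str κ) x ∧f conjunction κs

  qd-conjunction : 0 < N → ∀ κs → qd (conjunction κs) < N
  qd-conjunction 0<N []       = 0<N
  qd-conjunction 0<N (κ ∷ κs) =
    ⊔-lub (≤-<-trans (qd-beyond (ranker κ) _ _ x) (shallow κ)) (qd-conjunction 0<N κs)

  blocks-conjunction : ∀ κs → blocksFrom (just ∃q) (conjunction κs) ≤ k
  blocks-conjunction []       = z≤n
  blocks-conjunction (κ ∷ κs) = ⊔-lub
    (≤-trans (blocks-beyond-∃ (ranker κ) _ _ x) (alternations≤k (zoom κ) (dir κ)))
    (blocks-conjunction κs)

  free-conjunction : ∀ κs {z} → FreeIn z (conjunction κs) → z ≡ x
  free-conjunction (κ ∷ κs) (∧ˡ f) = free-beyond (ranker κ) _ _ x f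
  free-conjunction (κ ∷ κs) (∧ʳ f) = free-conjunction κs f

  sat-conjunction : ∀ b (σ : Assign (W b)) {i} → σ x ≡ just i → ∀ κs →
    Sat (W b) σ (conjunction κs) ⇔ All (Meets b i) κs
  sat-conjunction b σ σx []       = mk⇔ (λ _ → []) (λ _ → tt)
  sat-conjunction b σ σx (κ ∷ κs) = mk⇔
    (λ s → let s₁ , s₂ = to T-∧ s in to head s₁ ∷ to tail s₂)
    λ { (m ∷ ms) → from T-∧ (from head m , from tail ms) }
    where
    head = sat-beyond (W b) (reaches (zoom κ) b) σ (dir κ) (str κ) σx
    tail = sat-conjunction b σ σx κs

  -- The only use of the assumed equivalence. The sentence says that some position carries `a` and
  -- meets the constraints; its leading quantifier is the one block beyond the `k` allowed for
  -- zooming rankers.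
  witness-transfer : 0 < N → ∀ a κs b b′ → Witness a κs b → Witness a κs b′
  witness-transfer 0<N a κs b b′ = from′ ∘ subst T (E b b′ χ closed depth-ok blocks-ok) ∘ to′
    where
    body = letter a x ∧f conjunction κs
    χ = quant ∃q x body
    closed : Sentence χ
    closed z (under z≢x (∧ˡ letter)) = z≢x refl
    closed z (under z≢x (∧ʳ f))      = z≢x (free-conjunction κs f)
    depth-ok : qd χ ≤ N
    depth-ok = qd-conjunction 0<N κs
    blocks-ok : blocks χ ≤ suc k
    blocks-ok = s≤s (blocks-conjunction κs)
    to′ : Witness a κs b → T (W b ⊨ χ)
    to′ (i , wi , ms) = from (sat-∃ (W b) _ x body)
      (i , from T-∧
        ( from (sat-letter (W b) (update {w = W b} (λ _ → nothing) x i) {z = x} refl) wi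
        , from (sat-conjunction b _ refl κs) ms ))
    from′ : T (W b′ ⊨ χ) → Witness a κs b′
    from′ s with to (sat-∃ (W b′) _ x body) s
    ... | i , t with to T-∧ t
    ... | t₁ , t₂ = i ,
      to (sat-letter (W b′) (update {w = W b′} (λ _ → nothing) x i) {z = x} refl) t₁ ,
      to (sat-conjunction b′ _ refl κs) t₂

  start-unlettered : ∀ d b {a} → ¬ HasLetter (W b) a (start d (W b))
  start-unlettered d b (i , _ , i≡) =
    Rel-irrefl d (subst (Rel d strict _) i≡ (start-before d (W b) i))

  -- A sentinel carries no letter, and any other point carries the letter of the last step of its
  -- ranker in both words.
  letter-transfer : ∀ {r P a} → Zoom r P → ∀ b b′ → HasLetter (W b) a (P b) → HasLetter (W b′) a (P b′)
  letter-transfer (origin d P≡s) b b′ h rewrite P≡s b = ⊥-elim (start-unlettered d b h)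
  letter-transfer {a = a} (step _ _ _ _ _ _ leg) b b′ (i , refl , i≡)
    with First.at (Leg.first (leg b)) | First.at (Leg.first (leg b′))
  ... | j , refl , j≡ | h with pos-injective (trans i≡ (sym j≡))
  ... | refl = h

  -- Replacing steps by zooming steps.

  Zoomable : ℕ → Point → Set
  Zoomable n P = ∃ λ r → depth r ≤ n × Zoom r P

  module _ {r s P T} e a S (ζ : Zoom r P) (ξ : Zoom s T) (s≤r : depth s ≤ depth r) (r<N : depth r < N)
    (unique : Unique S) (alt : alternations r e ≤ length S)
    (before : ∀ b → Rel e strict (P b) (T b))
    (avoids : ∀ b i → lookup (W b) i ∈ S → Rel e strict (P b) (pos i) → ¬ Rel e strict (pos i) (T b))
    (rec : Zoomable (suc (depth s)) λ b → next (W b) e a (T b)) where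

    private
      between : List Constraint
      between = constraint ζ r<N e strict ∷ constraint ξ (≤-<-trans s≤r r<N) (flip e) strict ∷ []

      0<N : 0 < N
      0<N = ≤-<-trans z≤n r<N

      moves : Witness a between true → ∀ b → Leg (W b) e a S (P b) (next (W b) e a (P b)) (T b)
      moves wt b with witness-transfer 0<N a between true b wt | proj₂ (firstAfter (W b) e a (P b))
      ... | i , wi , p≺i ∷ _ ∷ []   | inj₂ (none , _) = ⊥-elim (none i wi p≺i)
      ... | i , wi , p≺i ∷ i≺t ∷ [] | inj₁ f = mkLeg f
        (Rel-transˡ e strict (First.least f i wi p≺i) (Rel-unswap e i≺t)) (avoids b)

      empty : ¬ Witness a between true → ∀ b j → lookup (W b) j ≡ a →
        Rel e strict (P b) (pos j) → ¬ Rel (flip e) strict (T b) (pos j)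
      empty ¬wt b j wj p≺j j≺t = ¬wt (witness-transfer 0<N a between b true (j , wj , p≺j ∷ j≺t ∷ []))

      arrives : ¬ Witness a between true → HasLetter (W true) a (T true) →
        ∀ b → First (W b) e a (P b) (T b)
      arrives ¬wt h b = mkFirst (letter-transfer ξ true b h) (before b) least
        where
        least : ∀ j → lookup (W b) j ≡ a → Rel e strict (P b) (pos j) → Rel e weak (T b) (pos j)
        least j wj p≺j with Rel-dichotomy (flip e) strict (T b) (pos j)
        ... | inj₁ j≺t = ⊥-elim (empty ¬wt b j wj p≺j j≺t)
        ... | inj₂ t≼j = subst (λ d → Rel d weak (T b) (pos j)) (flip-flip e) t≼j

    -- Three cases. If an `a` lies strictly before the bound `T`, the step is a new leg. If the
    -- first one is at `T`, the ranker of `T` already serves. Otherwise the step has the same result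
    -- when made from `T`, which `rec` handles. The case is decided in one word; `witness-transfer`
    -- and `letter-transfer` make it the same in the other.
    zoomable-extend : Zoomable (suc (depth r)) λ b → next (W b) e a (P b)
    zoomable-extend with any? (λ i → (lookup (W true) i ≟ᶠ a) ×-dec
                                     all? (λ κ → Rel? (dir κ) (str κ) (point κ true) (pos i)) between)
    ... | yes wt = step e a r , ≤-refl , step S ζ ξ (m≤n⇒m≤1+n s≤r) unique alt (moves wt)
    ... | no ¬wt with any? (λ i → (lookup (W true) i ≟ᶠ a) ×-dec (pos i ≟ T true))
    ... | yes h = s , m≤n⇒m≤1+n s≤r , zoom-resp (λ b → sym (next-first (W b) e a (arrives ¬wt h b))) ξ
    ... | no ¬h = let r′ , r′≤ , ζ′ = rec in r′ , ≤-trans r′≤ (s≤s s≤r) ,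
      zoom-resp (λ b → sym (next-skip (W b) e a (before b) (empty ¬wt b) (¬h ∘ letter-transfer ξ b true))) ζ′

  start-before-start : ∀ d b → Rel d strict (start d (W b)) (start (flip d) (W b))
  start-before-start right b = s≤s z≤n
  start-before-start left  b = s≤s z≤n

  next-start-flip : ∀ {P : Point} d a → (∀ b → P b ≡ start (flip d) (W b)) → ∀ b → P b ≡ next (W b) d a (P b)
  next-start-flip d a P≡s b rewrite P≡s b = sym (next-none (W b) d a λ j _ s≺j →
    Rel-absurd (flip d) weak (Rel-weaken (flip d) weak (start-before (flip d) (W b) j))
      (subst (λ e → Rel e strict (start (flip d) (W b)) (pos j)) (sym (flip-flip d)) s≺j))

  -- After a leg, the bound is kept if the direction is kept, and is the point before the leg if the
  -- direction changes. In both cases the bound comes with a subderivation of the given `Zoom`, on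
  -- which the fallback step recurses.
  zoomable-next : ∀ {r P} e a → Zoom r P → depth r < N →
    Zoomable (suc (depth r)) λ b → next (W b) e a (P b)
  zoomable-next e a (origin d P≡s) 0<N with compare-dir d e
  ... | same = zoomable-extend e a [] (origin d P≡s) (origin (flip d) λ _ → refl) z≤n 0<N [] z≤n
    (λ b → subst (λ p → Rel e strict p _) (sym (P≡s b)) (start-before-start e b)) (λ _ _ ())
    (origin (flip d) , z≤n , origin (flip d) (λ b → sym (next-start-flip e a (λ _ → refl) b)))
  -- Facing outwards at a sentinel, the step stays put by the default of `next`.
  ... | flipped = origin d , z≤n , zoom-resp (next-start-flip (flip d) a
    (λ b → subst (λ e → _ ≡ start e (W b)) (sym (flip-flip d)) (P≡s b))) (origin d P≡s)
  zoomable-next e a (step {r} {s} {Q} {T} {P} {d} {c} S ζ ξ s≤r u alt leg) r<N with compare-dir d e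
  ... | same = zoomable-extend e a S (step S ζ ξ s≤r u alt leg) ξ s≤r r<N u
    (subst (_≤ _) (sym (alternations-same d c r)) alt) (λ b → Leg.inside (leg b))
    (λ b i i∈S p≺i → Leg.avoids (leg b) i i∈S (Rel-trans d (First.ahead (Leg.first (leg b))) p≺i))
    (zoomable-next e a ξ (≤-<-trans s≤r r<N))
  -- `P` is the first `c` after `Q`, so `c` is missing strictly between them; the letters of `S`
  -- still are, as this interval lies within the one from `Q` to `T`.
  ... | flipped = zoomable-extend e a (c ∷ S) (step S ζ ξ s≤r u alt leg) ζ (n≤1+n _) r<N
    (¬Any⇒All¬ S (leg-fresh (leg true)) ∷ u) (subst (_≤ _) (sym (alternations-flip d c r)) (s≤s alt))
    (λ b → Rel-swap d (First.ahead (Leg.first (leg b)))) avoids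
    (zoomable-next e a ζ (<-trans (n<1+n _) r<N))
    where
    avoids : ∀ b i → lookup (W b) i ∈ c ∷ S → Rel e strict (P b) (pos i) → ¬ Rel e strict (pos i) (Q b)
    avoids b i (here wi) i≺p q≺i = Rel-absurd d strict (Rel-unswap d i≺p)
      (Rel-swap d (First.least (Leg.first (leg b)) i wi (Rel-unswap d q≺i)))
    avoids b i (there i∈S) i≺p q≺i =
      Leg.avoids (leg b) i i∈S (Rel-unswap d q≺i) (Rel-trans d (Rel-unswap d i≺p) (Leg.inside (leg b)))

  -- Order and letters between ranker points.

  lettered : ∀ {r P} → Zoom r P →
    (∃ λ d → ∀ b → P b ≡ start d (W b)) ⊎ (∃ λ a → ∀ b → HasLetter (W b) a (P b))
  lettered (origin d P≡s) = inj₁ (d , P≡s)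
  lettered (step _ _ _ _ _ _ leg) = inj₂ (_ , λ b → First.at (Leg.first (leg b)))

  module _ {r s P Q} (ζ : Zoom r P) (ξ : Zoom s Q) (r<N : depth r < N) (s<N : depth s < N) where

    -- Two opposite weak constraints pin the witness to the point `P`, so a relation between two
    -- points becomes a constraint on one quantified position.
    order-transfer-lettered : ∀ {a} → (∀ b → HasLetter (W b) a (P b)) →
      ∀ d c b b′ → Rel d c (P b) (Q b) → Rel d c (P b′) (Q b′)
    order-transfer-lettered h d c b b′ p≺q with h b
    ... | i , wi , i≡p
      with witness-transfer (≤-<-trans z≤n r<N) _
             (constraint ζ r<N right weak ∷ constraint ζ r<N left weak ∷ constraint ξ s<N (flip d) c ∷ [])
             b b′ (i , wi , ≤-reflexive (sym i≡p) ∷ ≤-reflexive i≡p ∷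
                   Rel-swap d (subst (λ p → Rel d c p (Q b)) (sym i≡p) p≺q) ∷ [])
    ... | j , _ , p≤j ∷ j≤p ∷ j≺q ∷ [] =
      subst (λ p → Rel d c p (Q b′)) (≤-antisym j≤p p≤j) (Rel-unswap d j≺q)

  -- One lettered point suffices, on either side. Two sentinels are ordered alike in every word.
  order-transfer : ∀ {r s P Q} → Zoom r P → Zoom s Q → depth r < N → depth s < N →
    ∀ d c b b′ → Rel d c (P b) (Q b) → Rel d c (P b′) (Q b′)
  order-transfer ζ ξ r<N s<N d c b b′ p≺q with lettered ζ | lettered ξ
  ... | inj₂ (_ , h) | _ = order-transfer-lettered ζ ξ r<N s<N h d c b b′ p≺q
  ... | inj₁ _ | inj₂ (_ , h) =
    Rel-unswap d (order-transfer-lettered ξ ζ s<N r<N h (flip d) c b b′ (Rel-swap d p≺q))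
  ... | inj₁ (e , P≡) | inj₁ (e′ , Q≡) rewrite P≡ b | P≡ b′ | Q≡ b | Q≡ b′ with compare-dir e e′
  ... | same    = Rel-diagonal d c p≺q
  ... | flipped = Rel-transport e (start-before-start e b) (start-before-start e b′) d c p≺q

  -- Positions of all rankers of depth at most n, not just the zooming ones.
  rankerPoints : ℕ → List Point
  rankerPoints zero    = (λ b → start right (W b)) ∷ (λ b → start left (W b)) ∷ []
  rankerPoints (suc n) = rankerPoints n ++
    cartesianProductWith (λ P (d , a) b → next (W b) d a (P b)) (rankerPoints n)
      (cartesianProduct (right ∷ left ∷ []) (allFin k))

  start∈ : ∀ d n → (λ b → start d (W b)) ∈ rankerPoints n
  start∈ right zero    = here refl
  start∈ left  zero    = there (here refl)
  start∈ d     (suc n) = ∈-++⁺ˡ (start∈ d n)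

  direction∈ : ∀ d → d ∈ right ∷ left ∷ []
  direction∈ right = here refl
  direction∈ left  = there (here refl)

  next∈ : ∀ {n P} d a → P ∈ rankerPoints n → (λ b → next (W b) d a (P b)) ∈ rankerPoints (suc n)
  next∈ {n} d a P∈ = ∈-++⁺ʳ (rankerPoints n)
    (∈-cartesianProductWith⁺ _ P∈ (∈-cartesianProduct⁺ (direction∈ d) (∈-allFin a)))

  -- The steps of an arbitrary ranker are replaced one by one through `zoomable-next`, without loss
  -- of depth. This extends the transfer results to all ranker points of depth below `N`.
  zoomable : ∀ {n P} → n < N → P ∈ rankerPoints n → Zoomable n P
  zoomable {zero}  _   (here refl)         = origin right , z≤n , origin right λ _ → refl
  zoomable {zero}  _   (there (here refl)) = origin left , z≤n , origin left λ _ → refl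
  zoomable {suc n} n<N P∈ with ∈-++⁻ (rankerPoints n) P∈
  ... | inj₁ P∈ₙ = let r , r≤n , ζ = zoomable (<-trans (n<1+n n) n<N) P∈ₙ in r , m≤n⇒m≤1+n r≤n , ζ
  ... | inj₂ P∈′ with ∈-cartesianProductWith⁻ _ (rankerPoints n) _ P∈′
  ... | _ , (d , a) , Q∈ , _ , refl with zoomable (<-trans (n<1+n n) n<N) Q∈
  ... | r , r≤n , ζ with zoomable-next d a ζ (≤-<-trans r≤n (<-trans (n<1+n n) n<N))
  ... | r′ , r′≤ , ζ′ = r′ , ≤-trans r′≤ (s≤s r≤n) , ζ′

  points-order : ∀ {n P Q} → n < N → P ∈ rankerPoints n → Q ∈ rankerPoints n →
    ∀ d c b b′ → Rel d c (P b) (Q b) → Rel d c (P b′) (Q b′)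
  points-order n<N P∈ Q∈ with zoomable n<N P∈ | zoomable n<N Q∈
  ... | _ , r≤n , ζ | _ , s≤n , ξ = order-transfer ζ ξ (≤-<-trans r≤n n<N) (≤-<-trans s≤n n<N)

  Between : Direction → Fin k → (b : Bool) → ℕ → ℕ → Set
  Between d a b p q = ∃ λ i → lookup (W b) i ≡ a × Rel d strict p (pos i) × Rel (flip d) strict q (pos i)

  points-between : ∀ {n P Q} → n < N → P ∈ rankerPoints n → Q ∈ rankerPoints n →
    ∀ d a b b′ → Between d a b (P b) (Q b) → Between d a b′ (P b′) (Q b′)
  points-between n<N P∈ Q∈ d a b b′ (i , wi , p≺i , i≺q) with zoomable n<N P∈ | zoomable n<N Q∈
  ... | _ , r≤n , ζ | _ , s≤n , ξ
    with witness-transfer (≤-<-trans z≤n n<N) a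
           (constraint ζ (≤-<-trans r≤n n<N) d strict ∷ constraint ξ (≤-<-trans s≤n n<N) (flip d) strict ∷ [])
           b b′ (i , wi , p≺i ∷ i≺q ∷ [])
  ... | j , wj , p≺j ∷ j≺q ∷ [] = j , wj , p≺j , j≺q

  -- Duplicator's answers.

  -- The invariant for a pair of pebbled positions with `n` rounds left.
  record Similar (n : ℕ) (b b′ : Bool) (i : Fin (length (W b))) (j : Fin (length (W b′))) : Set where
    constructor similar
    field
      letters : lookup (W b) i ≡ lookup (W b′) j
      cuts    : ∀ {P} → P ∈ rankerPoints n → ∀ d c → Rel d c (P b) (pos i) → Rel d c (P b′) (pos j)

  open Similar

  similar-sym : ∀ {n b b′ i j} → Similar n b b′ i j → Similar n b′ b j i
  similar-sym s = similar (sym (letters s)) λ P∈ → Rel-reflect (cuts s P∈)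

  similar-pred : ∀ {n b b′ i j} → Similar (suc n) b b′ i j → Similar n b b′ i j
  similar-pred s = similar (letters s) λ P∈ → cuts s (∈-++⁺ˡ P∈)

  record Gap (d : Direction) (n : ℕ) (b : Bool) (i : Fin (length (W b))) : Set where
    field
      {lower upper} : Point
      lower∈ : lower ∈ rankerPoints n
      upper∈ : upper ∈ rankerPoints n
      lower≺ : Rel d strict (lower b) (pos i)
      ≺upper : Rel (flip d) strict (upper b) (pos i)
      gap    : ∀ {Q} → Q ∈ rankerPoints n → Rel d weak (Q b) (lower b) ⊎ Rel d weak (upper b) (Q b)

  -- Off the ranker points, the nearest ones on either side bound the gap; they exist because both
  -- sentinels are ranker points.
  locate : ∀ d n b i → (∃ λ P → P ∈ rankerPoints n × P b ≡ pos i) ⊎ Gap d n b i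
  locate d n b i
    with nearest d (λ P → P b) (λ P → P b ≟ pos i) (rankerPoints n)
       | nearest (flip d) (λ P → P b) (λ P → Rel? d strict (P b) (pos i)) (rankerPoints n)
       | nearest d (λ P → P b) (λ P → Rel? (flip d) strict (P b) (pos i)) (rankerPoints n)
  ... | inj₂ (P , P∈ , P≡i , _) | _ | _ = inj₁ (P , P∈ , P≡i)
  ... | inj₁ _ | inj₁ none | _ = ⊥-elim (none (start∈ d n) (start-before d (W b) i))
  ... | inj₁ _ | inj₂ _ | inj₁ none = ⊥-elim (none (start∈ (flip d) n) (start-before (flip d) (W b) i))
  ... | inj₁ ≢i | inj₂ (_ , P₁∈ , P₁≺ , max) | inj₂ (_ , P₂∈ , ≺P₂ , min) = inj₂ record
    { lower∈ = P₁∈ ; upper∈ = P₂∈ ; lower≺ = P₁≺ ; ≺upper = ≺P₂ ; gap = split }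
    where
    split : ∀ {Q} → Q ∈ rankerPoints n → _
    split {Q} Q∈ with Rel-trichotomy d (Q b) (pos i)
    ... | inj₁ Q≺i        = inj₁ (Rel-unswap d (max Q∈ Q≺i))
    ... | inj₂ (inj₁ Q≡i) = ⊥-elim (≢i Q∈ Q≡i)
    ... | inj₂ (inj₂ i≺Q) = inj₂ (min Q∈ i≺Q)

  -- Every ranker point lies on one side of the gap, and on the same side in the other word by
  -- `points-order`. Its relations to `i` and `j` are then settled by strict order.
  gap-similar : ∀ {d n b b′ i j} → n < N → (g : Gap d n b i) → lookup (W b) i ≡ lookup (W b′) j →
    Rel d strict (Gap.lower g b′) (pos j) → Rel (flip d) strict (Gap.upper g b′) (pos j) →
    Similar n b b′ i j
  gap-similar {d} {n} {b} {b′} {i} {j} n<N g wi≡wj lower≺j j≺upper = similar wi≡wj cut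
    where
    open Gap g
    cut : ∀ {Q} → Q ∈ rankerPoints n → ∀ e c → Rel e c (Q b) (pos i) → Rel e c (Q b′) (pos j)
    cut Q∈ with gap Q∈
    ... | inj₁ Q≼lower = Rel-transport d (Rel-transˡ d strict Q≼lower lower≺)
      (Rel-transˡ d strict (points-order n<N Q∈ lower∈ d weak b b′ Q≼lower) lower≺j)
    ... | inj₂ upper≼Q = Rel-transport (flip d)
      (Rel-transˡ (flip d) strict (Rel-swap d upper≼Q) ≺upper)
      (Rel-transˡ (flip d) strict (Rel-swap d (points-order n<N upper∈ Q∈ d weak b b′ upper≼Q)) j≺upper)

  -- Here `p` is an anchor behind the move: a sentinel or the other pebble. A move onto a ranker
  -- point is answered by the same point. In a gap that starts at or after `p`, any occurrence of
  -- the letter in the corresponding gap will do. If `p` is past the lower end, the occurrence must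
  -- also be ahead of `p′`, which `occurs` provides.
  respond : ∀ d {n b b′ i p p′} → n < N → Rel d strict p (pos i) →
    (∀ {Q} → Q ∈ rankerPoints n → ∀ e c → Rel e c p (Q b) → Rel e c p′ (Q b′)) →
    (∀ {Q} → Q ∈ rankerPoints n →
      Between d (lookup (W b) i) b p (Q b) → Between d (lookup (W b) i) b′ p′ (Q b′)) →
    ∃ λ j → Similar n b b′ i j × Rel d strict p′ (pos j)
  respond d {n} {b} {b′} {i} {p} {p′} n<N p≺i order occurs with locate d n b i
  ... | inj₁ (P , P∈ , P≡i) with letter-transfer (proj₂ (proj₂ (zoomable n<N P∈))) b b′ (i , refl , sym P≡i)
  ... | j , wj , j≡P = j ,
    similar (sym wj) (λ {Q} Q∈ e c Q≺i → subst (Rel e c (Q b′)) (sym j≡P)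
      (points-order n<N Q∈ P∈ e c b b′ (subst (Rel e c (Q b)) (sym P≡i) Q≺i))) ,
    subst (Rel d strict p′) (sym j≡P) (order P∈ d strict (subst (Rel d strict p) (sym P≡i) p≺i))
  respond d {n} {b} {b′} {i} {p} {p′} n<N p≺i order occurs | inj₂ g
    with Rel-dichotomy d weak p (Gap.lower g b)
  ... | inj₁ p≼lower
    with points-between n<N (Gap.lower∈ g) (Gap.upper∈ g) d _ b b′ (i , refl , Gap.lower≺ g , Gap.≺upper g)
  ... | j , wj , lower≺j , j≺upper = j , gap-similar n<N g (sym wj) lower≺j j≺upper ,
    Rel-transˡ d strict (order (Gap.lower∈ g) d weak p≼lower) lower≺j
  respond d {n} {b} {b′} {i} {p} {p′} n<N p≺i order occurs | inj₂ g | inj₂ lower≺p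
    with occurs (Gap.upper∈ g) (i , refl , p≺i , Gap.≺upper g)
  ... | j , wj , p′≺j , j≺upper = j , gap-similar n<N g (sym wj)
    (Rel-trans d (Rel-unswap d (order (Gap.lower∈ g) (flip d) strict lower≺p)) p′≺j) j≺upper , p′≺j

  -- Searching back from `Q` for `a` gives a ranker point one level deeper, and `a` occurs in
  -- between iff this point is ahead of the pebble. This is where a round costs one level of depth.
  similar-occurs : ∀ d {n b b′ i j a Q} → Similar (suc n) b b′ i j → Q ∈ rankerPoints n →
    Between d a b (pos i) (Q b) → Between d a b′ (pos j) (Q b′)
  similar-occurs d {n} {b} {b′} {i} {j} {a} {Q} s Q∈ (l , wl , i≺l , l≺Q)
    with proj₂ (firstAfter (W b) (flip d) a (Q b)) | proj₂ (firstAfter (W b′) (flip d) a (Q b′))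
       | cuts s (next∈ {n} (flip d) a Q∈) (flip d) strict
  ... | inj₂ (none , _) | _ | _ = ⊥-elim (none l wl l≺Q)
  ... | inj₁ f | f′ | cut with f′ | cut (Rel-transˡ (flip d) strict (First.least f l wl l≺Q) (Rel-swap d i≺l))
  ... | inj₁ (mkFirst (l′ , wl′ , l′≡) n≺Q _) | j≺n = l′ , wl′ ,
    subst (Rel d strict (pos j)) (sym l′≡) (Rel-unswap d j≺n) ,
    subst (Rel (flip d) strict (Q b′)) (sym l′≡) n≺Q
  -- Without an `a` behind `Q`, the search ends at the sentinel behind `j`, not ahead of it.
  ... | inj₂ (_ , n≡) | j≺n = ⊥-elim (Rel-absurd d weak
    (Rel-weaken d weak (start-before d (W b′) j))
    (subst (λ p → Rel (flip d) strict p (pos j)) (trans n≡ (cong (λ e → start e (W b′)) (flip-flip d))) j≺n))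

  -- With no other pebble set, the left sentinel acts as the anchor.
  respond-free : ∀ {n} b b′ i → n < N → ∃ λ j → Similar n b b′ i j
  respond-free {n} b b′ i n<N with respond right {b′ = b′} n<N (start-before right (W b) i)
      (λ Q∈ e c → points-order n<N (start∈ right n) Q∈ e c b b′)
      (λ Q∈ → points-between n<N (start∈ right n) Q∈ right _ b b′)
  ... | j , s , _ = j , s

  respond-anchored : ∀ {n b b′ i₀ j₀} i → n < N → Similar (suc n) b b′ i₀ j₀ →
    ∃ λ j → Similar n b b′ i j × (∀ d c → Rel d c (pos i₀) (pos i) → Rel d c (pos j₀) (pos j))
  respond-anchored {n} {b} {b′} {i₀} {j₀} i n<N s = answer (Rel-trichotomy right (pos i₀) (pos i))
    where
    toward : ∀ d → Rel d strict (pos i₀) (pos i) → _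
    toward d i₀≺i with respond d n<N i₀≺i
      (λ Q∈ e c r → Rel-unswap e (cuts s (∈-++⁺ˡ Q∈) (flip e) c (Rel-swap e r)))
      (similar-occurs d s)
    ... | j , sj , j₀≺j = j , sj , Rel-transport d i₀≺i j₀≺j
    answer : _ → ∃ λ j → Similar n b b′ i j × (∀ d c → Rel d c (pos i₀) (pos i) → Rel d c (pos j₀) (pos j))
    answer (inj₁ i₀<i) = toward right i₀<i
    answer (inj₂ (inj₂ i<i₀)) = toward left i<i₀
    answer (inj₂ (inj₁ i₀≡i)) with pos-injective i₀≡i
    ... | refl = j₀ , similar-pred s , λ d c → Rel-diagonal d c

  -- The two-pebble game and preservation of formulas.

  data Paired (n : ℕ) (b b′ : Bool) : Maybe (Fin (length (W b))) → Maybe (Fin (length (W b′))) → Set where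
    unset : Paired n b b′ nothing nothing
    set   : ∀ {i j} → Similar n b b′ i j → Paired n b b′ (just i) (just j)

  -- Phrased by equations so that it is vacuous as long as a variable is unset.
  Ordered : ∀ b b′ → (mi mi′ : Maybe (Fin (length (W b)))) (mj mj′ : Maybe (Fin (length (W b′)))) → Set
  Ordered b b′ mi mi′ mj mj′ = ∀ {i i′ j j′} → mi ≡ just i → mi′ ≡ just i′ → mj ≡ just j → mj′ ≡ just j′ →
    ∀ d c → Rel d c (pos i) (pos i′) → Rel d c (pos j) (pos j′)

  record Match (n : ℕ) (b b′ : Bool) (σ : Assign (W b)) (τ : Assign (W b′)) : Set where
    constructor match
    field
      paired  : ∀ z → Paired n b b′ (σ z) (τ z)
      ordered : ∀ z → Ordered b b′ (σ z) (σ (other z)) (τ z) (τ (other z))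

  paired-sym : ∀ {n b b′ mi mj} → Paired n b b′ mi mj → Paired n b′ b mj mi
  paired-sym unset   = unset
  paired-sym (set s) = set (similar-sym s)

  paired-pred : ∀ {n b b′ mi mj} → Paired (suc n) b b′ mi mj → Paired n b b′ mi mj
  paired-pred unset   = unset
  paired-pred (set s) = set (similar-pred s)

  match-sym : ∀ {n b b′ σ τ} → Match n b b′ σ τ → Match n b′ b τ σ
  match-sym (match paired ordered) = match (λ z → paired-sym (paired z))
    λ z j≡ j′≡ i≡ i′≡ → Rel-reflect (ordered z i≡ i′≡ j≡ j′≡)

  answer : ∀ {n b b′ mi₀ mj₀} i → n < N → Paired (suc n) b b′ mi₀ mj₀ →
    ∃ λ j → Similar n b b′ i j × Ordered b b′ mi₀ (just i) mj₀ (just j)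
  answer i n<N unset with respond-free _ _ i n<N
  ... | j , s = j , s , λ ()
  answer i n<N (set s₀) with respond-anchored i n<N s₀
  ... | j , s , order = j , s , λ { refl refl refl refl → order }

  ordered-flip : ∀ {b b′ mi mi′ mj mj′} → Ordered b b′ mi mi′ mj mj′ → Ordered b b′ mi′ mi mj′ mj
  ordered-flip o i≡ i′≡ j≡ j′≡ d c r = Rel-unswap d (o i′≡ i≡ j′≡ j≡ (flip d) c (Rel-swap d r))

  match-update : ∀ {n b b′ σ τ} → n < N → Match (suc n) b b′ σ τ → ∀ z i →
    ∃ λ j → Match n b b′ (update {w = W b} σ z i) (update {w = W b′} τ z j)
  match-update n<N (match paired _) x i with answer i n<N (paired y)
  ... | j , s , o = j , match
    (λ { x → set s ; y → paired-pred (paired y) })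
    (λ { x → ordered-flip o ; y → o })
  match-update n<N (match paired _) y i with answer i n<N (paired x)
  ... | j , s , o = j , match
    (λ { y → set s ; x → paired-pred (paired x) })
    (λ { y → ordered-flip o ; x → o })

  match-ordered : ∀ {n b b′ σ τ} → Match n b b′ σ τ → ∀ z z′ → Ordered b b′ (σ z) (σ z′) (τ z) (τ z′)
  match-ordered m z z′ with compare-var z z′
  ... | swapped = Match.ordered m z
  ... | same    = diagonal
    where
    diagonal : ∀ {b b′ mi mj} → Ordered b b′ mi mi mj mj
    diagonal refl refl refl refl d c = Rel-diagonal d c

  -- An implication is enough, since the words may be exchanged: a universal quantifier is handled
  -- by answering in the reversed match. Atoms with an unset variable are false, which leaves only
  -- set pairs to treat.
  preserves : ∀ {n b b′ σ τ} → n ≤ N → Match n b b′ σ τ → ∀ φ → qd φ ≤ n →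
    Sat (W b) σ φ → Sat (W b′) τ φ
  preserves n≤N m ⊤f _ s = s
  preserves {σ = σ} {τ} n≤N m (letter a z) _ s with σ z | τ z | Match.paired m z
  ... | just i | just j | set sim = fromWitness (trans (sym (letters sim)) (toWitness s))
  preserves {σ = σ} {τ} n≤N m (nletter a z) _ s with σ z | τ z | Match.paired m z
  ... | just i | just j | set sim = fromWitnessFalse (toWitnessFalse s ∘ trans (letters sim))
  preserves {σ = σ} {τ} n≤N m (less z z′) _ s
    with σ z | τ z | σ z′ | τ z′ | Match.paired m z | Match.paired m z′ | match-ordered m z z′
  ... | _ | _ | _ | _ | set _ | set _ | o =
    <⇒<ᵇ (s≤s⁻¹ (o refl refl refl refl right strict (s≤s (<ᵇ⇒< _ _ s))))
  preserves {σ = σ} {τ} n≤N m (nless z z′) _ s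
    with σ z | τ z | σ z′ | τ z′ | Match.paired m z | Match.paired m z′ | match-ordered m z z′
  ... | _ | _ | _ | _ | set _ | set _ | o =
    from T-not λ t → ≤⇒≯
      (o refl refl refl refl left weak (s≤s (≮⇒≥ λ r → to T-not s (<⇒<ᵇ r)))) (s≤s (<ᵇ⇒< _ _ t))
  preserves {σ = σ} {τ} n≤N m (eq z z′) _ s
    with σ z | τ z | σ z′ | τ z′ | Match.paired m z | Match.paired m z′ | match-ordered m z z′
  ... | _ | _ | _ | _ | set _ | set _ | o = fromWitness (pos-injective (≤-antisym
    (o refl refl refl refl right weak (≤-reflexive i≡i′))
    (o refl refl refl refl left weak (≤-reflexive (sym i≡i′)))))
    where i≡i′ = cong pos (toWitness s)
  preserves {σ = σ} {τ} n≤N m (neq z z′) _ s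
    with σ z | τ z | σ z′ | τ z′ | Match.paired m z | Match.paired m z′ | match-ordered m z z′
  ... | _ | _ | _ | _ | set {i} _ | set {i′} _ | o with Rel-trichotomy right (pos i) (pos i′)
  ... | inj₁ i<i′ = fromWitnessFalse λ { refl → <-irrefl refl (o refl refl refl refl right strict i<i′) }
  ... | inj₂ (inj₁ i≡i′) = ⊥-elim (toWitnessFalse s (pos-injective i≡i′))
  ... | inj₂ (inj₂ i′<i) = fromWitnessFalse λ { refl → <-irrefl refl (o refl refl refl refl left strict i′<i) }
  preserves n≤N m (φ ∧f ψ) q s = let s₁ , s₂ = to T-∧ s in from T-∧
    ( preserves n≤N m φ (m⊔n≤o⇒m≤o (qd φ) (qd ψ) q) s₁
    , preserves n≤N m ψ (m⊔n≤o⇒n≤o (qd φ) (qd ψ) q) s₂ )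
  preserves n≤N m (φ ∨f ψ) q s with to T-∨ s
  ... | inj₁ s₁ = from T-∨ (inj₁ (preserves n≤N m φ (m⊔n≤o⇒m≤o (qd φ) (qd ψ) q) s₁))
  ... | inj₂ s₂ = from T-∨ (inj₂ (preserves n≤N m ψ (m⊔n≤o⇒n≤o (qd φ) (qd ψ) q) s₂))
  preserves {b = b} {b′} {σ} {τ} n≤N m (quant ∃q z φ) (s≤s q) s with to (sat-∃ (W b) σ z φ) s
  ... | i , t with match-update n≤N m z i
  ... | j , m′ = from (sat-∃ (W b′) τ z φ) (j , preserves (<⇒≤ n≤N) m′ φ q t)
  preserves {b = b} {b′} {σ} {τ} n≤N m (quant ∀q z φ) (s≤s q) s = from (sat-∀ (W b′) τ z φ) holds
    where
    holds : ∀ j → Sat (W b′) (update {w = W b′} τ z j) φ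
    holds j with match-update n≤N (match-sym m) z j
    ... | i , m′ = preserves (<⇒≤ n≤N) (match-sym m′) φ q (to (sat-∀ (W b) σ z φ) s i)

  equivalent : ∀ b b′ → Equiv2 N (W b) (W b′)
  equivalent b b′ φ _ q≤N = T⇔⇒≡ (implies b b′) (implies b′ b)
    where
    implies : ∀ b b′ → T (W b ⊨ φ) → T (W b′ ⊨ φ)
    implies b b′ = preserves ≤-refl (match (λ _ → unset) (λ _ ())) φ q≤N

theorem4p7 : (k : ℕ) (u v : Word k) (n : ℕ) →
    Equiv2Alt (suc k) n u v → Equiv2 n u v
theorem4p7 k u v n u≡v = Comparison.equivalent words equiv true false
  where
  words : Bool → Word k
  words true  = u
  words false = v
  equiv : ∀ b b′ → Equiv2Alt (suc k) n (words b) (words b′)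
  equiv true  true  φ _ _ _       = refl
  equiv true  false               = u≡v
  equiv false true  φ closed q bl = sym (u≡v φ closed q bl)
  equiv false false φ _ _ _       = refl
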